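{- Let $n$ be a composite positive integer for which there exists a positive integer $M$ with $M\,S_2(n) = \phi(n) - 1$, where $\phi$ is Euler's totient function and $S_2(n) = n\prod_{p \mid n}\left(1 - \frac{2}{p}\right)$. Let $K = \omega(n)$ be the number of distinct prime divisors of $n$. Then $$n < 2^{2^K + K} - 2^{2^{K-1} + K}.$$
   Context: $S_2$ is Schemmel's totient function, $S_2(n) = n\prod_{p\mid n}(1-2/p)$, the product being over the distinct primes dividing $n$. Such $n$ are called Deaconescu numbers. -}

module Defs where

open import Data.Nat using (ℕ; suc; _*_; _∸_; _/_; NonZero)
open import Data.Nat.Primality using (Prime; prime?)
open import Data.Nat.Divisibility using (_∣_; _∣?_)
open import Data.Nat.Coprimality using (Coprime; coprime?)
open import Data.List using (List; filter; upTo; length; map)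
open import Data.Nat.ListAction using (product)
open import Data.Product using (_×_)
open import Relation.Nullary.Decidable using (_×-dec_)

primeDivisors : ℕ → List ℕ
primeDivisors n = filter (λ p → prime? p ×-dec p ∣? n) (upTo (suc n))

ω : ℕ → ℕ
ω n = length (primeDivisors n)

φ : ℕ → ℕ
φ n = length (filter (λ k → coprime? k n) (map suc (upTo n)))

rad : ℕ → ℕ
rad n = product (primeDivisors n)

-- Schemmel's totient S₂(n) = n ∏_{p ∣ n} (1 - 2/p) = (n / rad n) * ∏_{p ∣ n} (p - 2)
-- (for p = 2 the factor p ∸ 2 = 0, matching 1 - 2/2 = 0; rad n ∣ n so the division is exact)
-- suc (rad n ∸ 1) = rad n, since rad n ≥ 1 (empty product is 1); written so to supply NonZero.
S₂ : ℕ → ℕ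
S₂ n = (n / suc (rad n ∸ 1)) * product (map (λ p → p ∸ 2) (primeDivisors n))

{-# OPTIONS --safe #-}
module Submission where

-- Write n = m rad(n).  Then φ(n) = m ∏(p-1) and S₂(n) = m ∏(p-2), so M S₂(n) = φ(n) - 1 forces
-- m ∣ 1: n is squarefree, and a size comparison shows that it is odd.  Sorting the values e = p - 2
-- and putting X = ∏(e+1), the equation reads M ∏e + 1 = X, as in Lehmer's totient problem.
-- Nielsen's bound X < 2^(2^K) - 2^(2^(K-1)) follows by comparing the numbers x = e+1 with the extremal
-- sequence 3, 5, 17, …, 2^(2^(K-2)) + 1, 2^(2^(K-1)): as log(1 - 1/x) is a concave increasing
-- function of log x, partial products larger than the extremal ones force ∏(1 - 1/x) to be larger too,
-- while a partial product that is not larger is handled by integrality (M ∏e > ∏(e+1) for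
-- every proper initial segment).  Finally n = ∏(e+2) ≤ 2^K X.

open import Defs
open import Data.Nat using (ℕ; _*_; _∸_; _+_; _^_; _<_)
open import Data.Nat.Primality using (Composite)
open import Relation.Binary.PropositionalEquality using (_≡_)

open import Data.Bool using (Bool; true; false; if_then_else_)
open import Data.List using (List; []; _∷_; map; length; filter; upTo; applyUpTo)
open import Data.List.Membership.Propositional using (_∈_)
open import Data.List.Membership.Propositional.Properties using (∈-filter⁺; ∈-upTo⁺)
open import Data.List.Properties using (length-map; map-applyUpTo)
open import Data.List.Relation.Unary.All as All using (All; []; _∷_; all?)
open import Data.List.Relation.Unary.All.Properties using (all-filter)
open import Data.List.Relation.Unary.AllPairs using (AllPairs; []; _∷_)
import Data.List.Relation.Unary.AllPairs.Properties as AllPairs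
open import Data.List.Relation.Unary.Linked as Linked using (Linked; _∷_)
open import Data.List.Relation.Unary.Linked.Properties as Linked using (AllPairs⇒Linked)
open import Data.Nat hiding (_*_; _∸_; _+_; _^_; _<_; ℕ)
open import Data.Nat.Coprimality using (Coprime; coprime?)
open import Data.Nat.Divisibility
open import Data.Nat.DivMod using (m*n/n≡m)
open import Data.Nat.ListAction using (product)
open import Data.Nat.Primality hiding (Composite)
open import Data.Nat.Primality.Factorisation using (factorise)
open import Data.Nat.Properties
open import Data.Nat.Tactic.RingSolver using (solve-∀)
open import Data.Product using (_×_; _,_; proj₁; proj₂; ∃)
open import Data.Sum using (inj₁; inj₂)
open import Function using (_∘_; id; _⇔_; mk⇔)
open import Relation.Binary.PropositionalEquality hiding (_≡_)
open import Relation.Nullary using (Dec; does; contradiction; ¬?)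
open import Relation.Nullary.Decidable using (does-⇔; dec-true; dec-false; decidable-stable; _×-dec_)
open import Relation.Unary using (Decidable)
open ≤-Reasoning

-- Bernoulli's inequality and powers of ratios.

2xy≤x²+y² : ∀ x y → x * y + x * y ≤ x * x + y * y
2xy≤x²+y² x y with ≤-total x y
... | inj₁ x≤y with d , refl ← m≤n⇒∃[o]m+o≡n x≤y = begin
  x * (x + d) + x * (x + d)         ≤⟨ m≤m+n _ (d * d) ⟩
  x * (x + d) + x * (x + d) + d * d ≡⟨ expand x d ⟩
  x * x + (x + d) * (x + d)         ∎
  where
  expand : ∀ x d → x * (x + d) + x * (x + d) + d * d ≡ x * x + (x + d) * (x + d)
  expand = solve-∀
... | inj₂ y≤x with d , refl ← m≤n⇒∃[o]m+o≡n y≤x = begin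
  (y + d) * y + (y + d) * y         ≤⟨ m≤m+n _ (d * d) ⟩
  (y + d) * y + (y + d) * y + d * d ≡⟨ expand y d ⟩
  (y + d) * (y + d) + y * y         ∎
  where
  expand : ∀ y d → (y + d) * y + (y + d) * y + d * d ≡ (y + d) * (y + d) + y * y
  expand = solve-∀

-- Weighted AM-GM for `x ^ suc n` and `n` copies of `y ^ suc n`, that is, Bernoulli's inequality
-- cleared of denominators.
bernoulli : ∀ x y n → suc n * y ^ n * x ≤ x ^ suc n + n * y ^ suc n
bernoulli x y zero = ≤-reflexive (base x)
  where
  base : ∀ x → 1 * 1 * x ≡ x * 1 + 0
  base = solve-∀
bernoulli x y (suc n) = +-cancelʳ-≤ (n * (x * y * b)) _ _ (begin
  suc (suc n) * (y * b) * x + n * (x * y * b)          ≡⟨ collect x y b n ⟩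
  suc n * b * (x * y + x * y)                          ≤⟨ *-monoʳ-≤ (suc n * b) (2xy≤x²+y² x y) ⟩
  suc n * b * (x * x + y * y)                          ≡⟨ split x y b n ⟩
  x * (suc n * b * x) + suc n * (y * (y * b))          ≤⟨ +-monoˡ-≤ _ (*-monoʳ-≤ x (bernoulli x y n)) ⟩
  x * (x * a + n * (y * b)) + suc n * (y * (y * b))    ≡⟨ regroup x y a b n ⟩
  x * (x * a) + suc n * (y * (y * b)) + n * (x * y * b) ∎)
  where
  a = x ^ n
  b = y ^ n
  collect : ∀ x y b n → suc (suc n) * (y * b) * x + n * (x * y * b) ≡ suc n * b * (x * y + x * y)
  collect = solve-∀
  split : ∀ x y b n → suc n * b * (x * x + y * y) ≡ x * (suc n * b * x) + suc n * (y * (y * b))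
  split = solve-∀
  regroup : ∀ x y a b n → x * (x * a + n * (y * b)) + suc n * (y * (y * b)) ≡ x * (x * a) + suc n * (y * (y * b)) + n * (x * y * b)
  regroup = solve-∀

-- With x = e+1 and w = u+1 this says ((1 - 1/x)/(1 - 1/w))^(x-1) ≥ x/w, the tangent inequality at x
-- of log(1 - 1/x) as a concave function of log x, whose slope there is 1/(x-1).
tangent : ∀ e u → suc e * (suc e * u) ^ e ≤ (e * suc u) ^ e * suc u
tangent zero u = s≤s z≤n
tangent e@(suc _) u = *-cancelˡ-≤ e (+-cancelʳ-≤ (e * (suc e * u * b)) _ _ (begin
  e * (suc e * b) + e * (suc e * u * b)     ≡⟨ collect e u b ⟩
  -- With these bases `suc e * (e * suc u)` exceeds `e * (suc e * u)` by `e * suc e`, so cancelling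
  -- leaves `e` times the claim.
  suc e * b * (e * suc u)                   ≤⟨ bernoulli (e * suc u) (suc e * u) e ⟩
  e * suc u * a + e * (suc e * u * b)       ≡⟨ cong (_+ e * (suc e * u * b)) (regroup e u a) ⟩
  e * (a * suc u) + e * (suc e * u * b)     ∎))
  where
  a = (e * suc u) ^ e
  b = (suc e * u) ^ e
  collect : ∀ e u b → e * (suc e * b) + e * (suc e * u * b) ≡ suc e * b * (e * suc u)
  collect = solve-∀
  regroup : ∀ e u a → e * suc u * a ≡ e * (a * suc u)
  regroup = solve-∀

^-distribʳ-* : ∀ x y n → (x * y) ^ n ≡ x ^ n * y ^ n
^-distribʳ-* x y zero = refl
^-distribʳ-* x y (suc n) = trans (cong (x * y *_) (^-distribʳ-* x y n)) (interchange x y (x ^ n) (y ^ n))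
  where
  interchange : ∀ x y a b → x * y * (a * b) ≡ x * a * (y * b)
  interchange = solve-∀

-- With Q = q/r ≥ 1, the bound Q^d ≥ s/t passes to larger exponents. The sortedness of the factors
-- enters through this.
raise : ∀ s t r q {d e} → d ≤ e → r ≤ q → s * r ^ d ≤ q ^ d * t → s * r ^ e ≤ q ^ e * t
raise s t r q {d} d≤e r≤q h with c , refl ← m≤n⇒∃[o]m+o≡n d≤e = begin
  s * r ^ (d + c)       ≡⟨ cong (s *_) (^-distribˡ-+-* r d c) ⟩
  s * (r ^ d * r ^ c)   ≡⟨ *-assoc s _ _ ⟨
  s * r ^ d * r ^ c     ≤⟨ *-mono-≤ h (^-monoˡ-≤ c r≤q) ⟩
  q ^ d * t * q ^ c     ≡⟨ swap (q ^ d) t (q ^ c) ⟩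
  q ^ d * q ^ c * t     ≡⟨ cong (_* t) (^-distribˡ-+-* q d c) ⟨
  q ^ (d + c) * t       ∎
  where
  swap : ∀ a t b → a * t * b ≡ a * b * t
  swap = solve-∀

-- Multiplies Q^e ≥ s/t by `tangent`: for x = e+1 and w = u+1, Q = q/r gains the factor (1 - 1/x)/(1
-- - 1/w) and s/t gains x/w.
extend : ∀ s t r q e u → s * r ^ e ≤ q ^ e * t →
  s * suc e * (r * (suc e * u)) ^ e ≤ (q * (e * suc u)) ^ e * (t * suc u)
extend s t r q e u h = begin
  s * suc e * (r * (suc e * u)) ^ e             ≡⟨ cong (s * suc e *_) (^-distribʳ-* r _ e) ⟩
  s * suc e * (r ^ e * (suc e * u) ^ e)         ≡⟨ inter s (suc e) (r ^ e) _ ⟩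
  s * r ^ e * (suc e * (suc e * u) ^ e)         ≤⟨ *-mono-≤ h (tangent e u) ⟩
  q ^ e * t * ((e * suc u) ^ e * suc u)         ≡⟨ inter (q ^ e) t _ (suc u) ⟩
  q ^ e * (e * suc u) ^ e * (t * suc u)         ≡⟨ cong (_* (t * suc u)) (^-distribʳ-* q _ e) ⟨
  (q * (e * suc u)) ^ e * (t * suc u)           ∎
  where
  inter : ∀ a b c d → a * b * (c * d) ≡ a * c * (b * d)
  inter = solve-∀

-- With Q = q/r, Q < 1 would give Q^(e+1) < 1 ≤ s/t. This serves the case of a partial product at
-- least as large as the extremal one.
excess⇒base≤ : ∀ {s t r q} e → 0 < t → 0 < r → t ≤ s → s * r ^ suc e ≤ q ^ suc e * t → r ≤ q
excess⇒base≤ {s} {t} {r} {q} e 0<t 0<r t≤s h with ≤-<-connex r q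
... | inj₁ r≤q = r≤q
... | inj₂ q<r = contradiction h (<⇒≱ (begin-strict
  q ^ suc e * t  ≡⟨ *-comm (q ^ suc e) t ⟩
  t * q ^ suc e  <⟨ *-monoʳ-< t {{>-nonZero 0<t}} (^-monoˡ-< (suc e) q<r) ⟩
  t * r ^ suc e  ≤⟨ *-monoˡ-≤ _ t≤s ⟩
  s * r ^ suc e  ∎))

-- Size of the solutions of M ∏e + 1 = ∏(e+1).

product-suc>0 : ∀ es → 0 < product (map suc es)
product-suc>0 [] = s≤s z≤n
product-suc>0 (e ∷ es) = *-mono-≤ (s≤s (z≤n {e})) (product-suc>0 es)

product≤product-suc : ∀ es → product es ≤ product (map suc es)
product≤product-suc [] = ≤-refl
product≤product-suc (e ∷ es) = *-mono-≤ (n≤1+n e) (product≤product-suc es)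

product<product-suc : ∀ e es → product (e ∷ es) < product (map suc (e ∷ es))
product<product-suc e es = begin-strict
  e * product es                 ≤⟨ *-monoʳ-≤ e (product≤product-suc es) ⟩
  e * product (map suc es)       <⟨ m<n+m _ (product-suc>0 es) ⟩
  suc e * product (map suc es)   ∎

-- Integrality: if A ≤ X, then ∏(e+1) ≥ ∏e + 1 makes the right side exceed the left by at least X -
-- 1 > 0.
numerator< : ∀ X A e es → 1 < X →
  A * product (e ∷ es) + 1 ≡ X * product (map suc (e ∷ es)) → X < A
numerator< X A e es 1<X eq with <-≤-connex X A
... | inj₁ X<A = X<A
... | inj₂ A≤X = contradiction eq (<⇒≢ (begin-strict
  A * P + 1    ≤⟨ +-monoˡ-≤ 1 (*-monoˡ-≤ P A≤X) ⟩
  X * P + 1    <⟨ +-monoʳ-< (X * P) 1<X ⟩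
  X * P + X    ≡⟨ +-comm (X * P) X ⟩
  X + X * P    ≡⟨ *-suc X P ⟨
  X * suc P    ≤⟨ *-monoʳ-≤ X (product<product-suc e es) ⟩
  X * product (map suc (e ∷ es)) ∎))
  where
  P = product (e ∷ es)

-- After i factors F = 2^(2^i) - 1, X is the product of the e+1 and A is M times the product of the e so far.
-- With Q = A F / (X (F+1)) the two invariants are Q ≥ 1 and Q^d ≥ X / F, where d is the last e.
-- The next comparison value is w = F+2, except for the last factor, where it is w = F+1.
productBound : ∀ F X A d e es → 0 < F → 0 < X → 0 < d → Linked _≤_ (d ∷ e ∷ es) →
  X * suc F ≤ A * F → X * (X * suc F) ^ d ≤ (A * F) ^ d * F →
  A * product (e ∷ es) + 1 ≡ X * product (map suc (e ∷ es)) →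
  let D = suc F ^ (2 ^ length es) in X * product (map suc (e ∷ es)) + D < D * D
productBound F X A d zero es _ _ 0<d (d≤0 ∷ _) = contradiction d≤0 (<⇒≱ 0<d)
productBound F X A d e@(suc e-1) [] 0<F 0<X 0<d (d≤e ∷ _) inv₁ inv₂ eq
  with <-≤-connex (X * suc e) (F * suc F)
-- As F(F+1) + (F+1) = (F+1)^2, the bound says exactly that the product stays below the extremal
-- value F(F+1).
... | inj₁ small = begin-strict
  X * (suc e * 1) + suc F ^ 1     ≡⟨ cong₂ (λ a b → X * a + b) (*-identityʳ (suc e)) (^-identityʳ (suc F)) ⟩
  X * suc e + suc F               <⟨ +-monoˡ-< (suc F) small ⟩
  F * suc F + suc F               ≡⟨ +-comm (F * suc F) (suc F) ⟩
  suc F * suc F                   ≡⟨ cong₂ _*_ (^-identityʳ (suc F)) (^-identityʳ (suc F)) ⟨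
  suc F ^ 1 * suc F ^ 1           ∎
-- Otherwise concavity gives Q ≥ 1. The comparison value F+1 cancels the factors F and F+1, so Q is
-- now A e / (X (e+1)), against A e + 1 = X (e+1).
... | inj₂ large = contradiction X′≤A′ (<⇒≱ A′<X′)
  where
  0<FE : 0 < F * suc F
  0<FE = *-mono-≤ 0<F (s≤s (z≤n {F}))
  regroupX : ∀ X e F → X * suc F * (suc e * F) ≡ X * suc e * (F * suc F)
  regroupX = solve-∀
  regroupA : ∀ A e F → A * F * (e * suc F) ≡ A * e * (F * suc F)
  regroupA = solve-∀
  inv₂′ : X * suc e * (X * suc e * (F * suc F)) ^ e ≤ (A * e * (F * suc F)) ^ e * (F * suc F)
  inv₂′ = subst₂ (λ r q → X * suc e * r ^ e ≤ q ^ e * (F * suc F)) (regroupX X e F) (regroupA A e F)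
    (extend X F (X * suc F) (A * F) e F (raise X F (X * suc F) (A * F) d≤e inv₁ inv₂))
  X′≤A′ : X * suc e ≤ A * e
  X′≤A′ = *-cancelʳ-≤ _ _ (F * suc F) {{>-nonZero 0<FE}}
    (excess⇒base≤ e-1 0<FE (*-mono-≤ (*-mono-≤ 0<X (s≤s (z≤n {e}))) 0<FE) large inv₂′)
  A′<X′ : A * e < X * suc e
  A′<X′ = ≤-reflexive (begin-equality
    suc (A * e)         ≡⟨ +-comm 1 (A * e) ⟩
    A * e + 1           ≡⟨ cong (λ a → A * a + 1) (*-identityʳ e) ⟨
    A * (e * 1) + 1     ≡⟨ eq ⟩
    X * (suc e * 1)     ≡⟨ cong (X *_) (*-identityʳ (suc e)) ⟩
    X * suc e           ∎)
productBound F X A d e@(suc e-1) (f ∷ es) 0<F 0<X 0<d (d≤e ∷ sorted) inv₁ inv₂ eq =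
  subst₂ (λ x D → x + D < D * D) (*-assoc X (suc e) _) base-eq
    (productBound F′ (X * suc e) (A * e) e f es 0<F′ (<-trans z<s 1<X′) z<s sorted inv₁′ inv₂′ eq′)
  where
  -- F(F+2) = (F+1)^2 - 1, so `suc F` is squared at each step.
  F′ = F * suc (suc F)
  0<F′ : 0 < F′
  0<F′ = *-mono-≤ 0<F (s≤s (z≤n {suc F}))
  1<X′ : 1 < X * suc e
  1<X′ = *-mono-≤ 0<X (s≤s (s≤s (z≤n {e-1})))
  eq′ : A * e * product (f ∷ es) + 1 ≡ X * suc e * product (map suc (f ∷ es))
  eq′ = trans (cong (_+ 1) (*-assoc A e _)) (trans eq (sym (*-assoc X (suc e) _)))
  square : ∀ F → suc F * (suc F * 1) ≡ suc (F * suc (suc F))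
  square = solve-∀
  base-eq : suc F′ ^ (2 ^ length es) ≡ suc F ^ (2 ^ length (f ∷ es))
  base-eq = trans (cong (_^ (2 ^ length es)) (sym (square F))) (^-*-assoc (suc F) 2 (2 ^ length es))
  regroupX : ∀ X e F → X * suc F * (suc e * suc F) ≡ X * suc e * suc (F * suc (suc F))
  regroupX = solve-∀
  regroupA : ∀ A e F → A * F * (e * suc (suc F)) ≡ A * e * (F * suc (suc F))
  regroupA = solve-∀
  inv₂′ : X * suc e * (X * suc e * suc F′) ^ e ≤ (A * e * F′) ^ e * F′
  inv₂′ = subst₂ (λ r q → X * suc e * r ^ e ≤ q ^ e * F′) (regroupX X e F) (regroupA A e F)
    (extend X F (X * suc F) (A * F) e (suc F) (raise X F (X * suc F) (A * F) d≤e inv₁ inv₂))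
  inv₁′ : X * suc e * suc F′ ≤ A * e * F′
  inv₁′ with ≤-total F′ (X * suc e)
  -- The partial product is at least the extremal one: concavity suffices.
  ... | inj₁ F′≤X′ = excess⇒base≤ e-1 0<F′ (*-mono-≤ (<-trans z<s 1<X′) (s≤s (z≤n {F′}))) F′≤X′ inv₂′
  -- Otherwise integrality gives A e ≥ X (e+1) + 1, a relative gain of at least 1/(X (e+1)) ≥ 1/F′.
  ... | inj₂ X′≤F′ = begin
    X * suc e * suc F′          ≡⟨ *-suc (X * suc e) F′ ⟩
    X * suc e + X * suc e * F′  ≤⟨ +-monoˡ-≤ _ X′≤F′ ⟩
    suc (X * suc e) * F′        ≤⟨ *-monoˡ-≤ F′ (numerator< (X * suc e) (A * e) f es 1<X′ eq′) ⟩
    A * e * F′                  ∎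

-- Sums over 1, ..., n.

-- Shifting `f` mirrors the recursion of `applyUpTo`; starting at `f 1` matches the range over which
-- `φ` counts.
Σ₁ : (ℕ → ℕ) → ℕ → ℕ
Σ₁ f zero    = 0
Σ₁ f (suc n) = f 1 + Σ₁ (f ∘ suc) n

Σ₁-cong : ∀ {f g} n → (∀ k → f k ≡ g k) → Σ₁ f n ≡ Σ₁ g n
Σ₁-cong zero    f≗g = refl
Σ₁-cong (suc n) f≗g = cong₂ _+_ (f≗g 1) (Σ₁-cong n (f≗g ∘ suc))

Σ₁-distrib-+ : ∀ f g n → Σ₁ (λ k → f k + g k) n ≡ Σ₁ f n + Σ₁ g n
Σ₁-distrib-+ f g zero    = refl
Σ₁-distrib-+ f g (suc n) = trans (cong (f 1 + g 1 +_) (Σ₁-distrib-+ (f ∘ suc) (g ∘ suc) n))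
  (interchange (f 1) (g 1) (Σ₁ (f ∘ suc) n) (Σ₁ (g ∘ suc) n))
  where
  interchange : ∀ a b c d → a + b + (c + d) ≡ a + c + (b + d)
  interchange = solve-∀

Σ₁-split : ∀ f m n → Σ₁ f (m + n) ≡ Σ₁ f m + Σ₁ (λ k → f (m + k)) n
Σ₁-split f zero    n = refl
Σ₁-split f (suc m) n = trans (cong (f 1 +_) (Σ₁-split (f ∘ suc) m n)) (sym (+-assoc (f 1) _ _))

Σ₁-zero : ∀ f n → (∀ k → 0 < k → k ≤ n → f k ≡ 0) → Σ₁ f n ≡ 0
Σ₁-zero f zero    f≗0 = refl
Σ₁-zero f (suc n) f≗0 = cong₂ _+_ (f≗0 1 z<s (s≤s z≤n))
  (Σ₁-zero (f ∘ suc) n (λ k _ k≤n → f≗0 (suc k) z<s (s≤s k≤n)))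

Σ₁-one : ∀ n → Σ₁ (λ _ → 1) n ≡ n
Σ₁-one zero    = refl
Σ₁-one (suc n) = cong suc (Σ₁-one n)

𝟙 : Bool → ℕ
𝟙 b = if b then 1 else 0

length-filter-applyUpTo : ∀ {P : ℕ → Set} (P? : Decidable P) g f n →
  (∀ i → f (suc i) ≡ 𝟙 (does (P? (g i)))) → length (filter P? (applyUpTo g n)) ≡ Σ₁ f n
length-filter-applyUpTo P? g f zero    f≗ = refl
length-filter-applyUpTo P? g f (suc n) f≗
  with ih ← length-filter-applyUpTo P? (g ∘ suc) (f ∘ suc) n (f≗ ∘ suc) | does (P? (g 0)) | f≗ 0
... | true  | f1≡1 = cong₂ _+_ (sym f1≡1) ih
... | false | f1≡0 = cong₂ _+_ (sym f1≡0) ih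

restrict : ℕ → (ℕ → ℕ) → ℕ → ℕ
restrict p f k = if does (p ∣? k) then f k else 0

-- Cut 1, ..., m p into m blocks of length p: only the last entry of each block is a multiple of p.
Σ₁-multiples : ∀ p .{{_ : NonZero p}} f m → Σ₁ (restrict p f) (m * p) ≡ Σ₁ (λ j → f (p * j)) m
Σ₁-multiples p f zero = refl
Σ₁-multiples p@(suc q) f (suc m) = begin-equality
  Σ₁ (restrict p f) (p + m * p)                                       ≡⟨ Σ₁-split (restrict p f) p (m * p) ⟩
  Σ₁ (restrict p f) p + Σ₁ (λ k → restrict p f (p + k)) (m * p)       ≡⟨ cong₂ _+_ firstBlock (Σ₁-cong (m * p) shift) ⟩
  f p + Σ₁ (restrict p (λ k → f (p + k))) (m * p)                     ≡⟨ cong₂ _+_ (cong f (sym (*-identityʳ p))) (Σ₁-multiples p (λ k → f (p + k)) m) ⟩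
  f (p * 1) + Σ₁ (λ j → f (p + p * j)) m                              ≡⟨ cong (f (p * 1) +_) (Σ₁-cong m (λ j → cong f (sym (*-suc p j)))) ⟩
  f (p * 1) + Σ₁ (λ j → f (p * suc j)) m                              ∎
  where
  last : restrict p f p ≡ f p
  last rewrite dec-true (p ∣? p) ∣-refl = refl
  others : ∀ k → 0 < k → k ≤ q → restrict p f k ≡ 0
  others k 0<k k≤q rewrite dec-false (p ∣? k) (λ p∣k → <⇒≱ (s≤s k≤q) (∣⇒≤ {{>-nonZero 0<k}} p∣k)) = refl
  firstBlock : Σ₁ (restrict p f) p ≡ f p
  firstBlock = begin-equality
    Σ₁ (restrict p f) p                             ≡⟨ cong (Σ₁ (restrict p f)) (+-comm 1 q) ⟩
    Σ₁ (restrict p f) (q + 1)                       ≡⟨ Σ₁-split (restrict p f) q 1 ⟩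
    Σ₁ (restrict p f) q + (restrict p f (q + 1) + 0) ≡⟨ cong₂ _+_ (Σ₁-zero _ q others) (+-identityʳ _) ⟩
    restrict p f (q + 1)                            ≡⟨ cong (restrict p f) (+-comm q 1) ⟩
    restrict p f p                                  ≡⟨ last ⟩
    f p                                             ∎
  shift : ∀ k → restrict p f (p + k) ≡ restrict p (λ k → f (p + k)) k
  shift k = cong (if_then f (p + k) else 0)
    (does-⇔ (mk⇔ (λ h → ∣m+n∣m⇒∣n h ∣-refl) (∣m∣n⇒∣m+n ∣-refl)) (p ∣? (p + k)) (p ∣? k))

-- Sieving by distinct primes.

avoids? : ∀ ps k → Dec (All (_∤ k) ps)
avoids? ps k = all? (λ p → ¬? (p ∣? k)) ps

χ : List ℕ → ℕ → ℕ
χ ps k = 𝟙 (does (avoids? ps k))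

-- A number avoiding `ps` either avoids p as well or is a multiple of p.
χ-sieve : ∀ p ps k → χ (p ∷ ps) k + restrict p (χ ps) k ≡ χ ps k
χ-sieve p ps k with does (p ∣? k)
... | true  = refl
... | false = +-identityʳ _

prime∣prime⇒≡ : ∀ {p q} → Prime p → Prime q → q ∣ p → q ≡ p
prime∣prime⇒≡ pp pq q∣p with prime⇒irreducible pp q∣p
... | inj₁ refl = contradiction pq ¬prime[1]
... | inj₂ q≡p = q≡p

prime∣m*p⇒∣m : ∀ {p q} m → Prime p → Prime q → p < q → q ∣ m * p → q ∣ m
prime∣m*p⇒∣m {p} m pp pq p<q q∣mp with euclidsLemma m p pq q∣mp
... | inj₁ q∣m = q∣m
... | inj₂ q∣p = contradiction (sym (prime∣prime⇒≡ pp pq q∣p)) (<⇒≢ p<q)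

-- The primes in `ps` differ from p, so by Euclid's lemma a factor p does not affect divisibility by
-- them.
χ-scale : ∀ {p} ps → Prime p → All Prime ps → All (p <_) ps → ∀ j → χ ps (p * j) ≡ χ ps j
χ-scale {p} ps pp primes above j = cong 𝟙 (does-⇔ (mk⇔
  (All.map (λ q∤pj q∣j → q∤pj (∣n⇒∣m*n p q∣j)))
  (λ avoid → All.zipWith (λ {q} ((pq , p<q) , q∤j) q∣pj → q∤j (prime∣m*p⇒∣m j pp pq p<q (subst (q ∣_) (*-comm p j) q∣pj)))
    (All.zip (primes , above) , avoid)))
  (avoids? ps (p * j)) (avoids? ps j))

-- Legendre's sieve: of the m p Φ numbers up to m p R avoiding `ps`, the multiples of p are p j with
-- j ≤ m R avoiding `ps`, which number m Φ. The free factor m lets the induction hypothesis serve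
-- both counts.
Σ₁-χ : ∀ ps m → All Prime ps → AllPairs _<_ ps →
  Σ₁ (χ ps) (m * product ps) ≡ m * product (map (_∸ 1) ps)
Σ₁-χ [] m _ _ = Σ₁-one (m * 1)
Σ₁-χ (zero ∷ ps) m (pp ∷ _) = contradiction pp ¬prime[0]
Σ₁-χ (p@(suc q) ∷ ps) m (pp ∷ primes) (above ∷ sorted) = +-cancelʳ-≡ (m * Φ) _ _ (begin-equality
  Σ₁ (χ (p ∷ ps)) N + m * Φ                            ≡⟨ cong (Σ₁ (χ (p ∷ ps)) N +_) multiples ⟨
  Σ₁ (χ (p ∷ ps)) N + Σ₁ (restrict p (χ ps)) N         ≡⟨ Σ₁-distrib-+ _ _ N ⟨
  Σ₁ (λ k → χ (p ∷ ps) k + restrict p (χ ps) k) N      ≡⟨ Σ₁-cong N (χ-sieve p ps) ⟩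
  Σ₁ (χ ps) N                                          ≡⟨ cong (Σ₁ (χ ps)) (*-assoc m p R) ⟨
  Σ₁ (χ ps) (m * p * R)                                ≡⟨ Σ₁-χ ps (m * p) primes sorted ⟩
  m * p * Φ                                            ≡⟨ expand m q Φ ⟩
  m * (q * Φ) + m * Φ                                  ∎)
  where
  R = product ps
  Φ = product (map (_∸ 1) ps)
  N = m * (p * R)
  regroup : ∀ m p R → m * (p * R) ≡ m * R * p
  regroup = solve-∀
  expand : ∀ m q Φ → m * suc q * Φ ≡ m * (q * Φ) + m * Φ
  expand = solve-∀
  multiples : Σ₁ (restrict p (χ ps)) N ≡ m * Φ
  multiples = begin-equality
    Σ₁ (restrict p (χ ps)) N             ≡⟨ cong (Σ₁ (restrict p (χ ps))) (regroup m p R) ⟩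
    Σ₁ (restrict p (χ ps)) (m * R * p)   ≡⟨ Σ₁-multiples p (χ ps) (m * R) ⟩
    Σ₁ (λ j → χ ps (p * j)) (m * R)      ≡⟨ Σ₁-cong (m * R) (χ-scale ps pp primes above) ⟩
    Σ₁ (χ ps) (m * R)                    ≡⟨ Σ₁-χ ps m primes sorted ⟩
    m * Φ                                ∎

-- Writing n = k p, the remaining primes divide k by Euclid's lemma, since they differ from p.
product-primes-∣ : ∀ ps n → All Prime ps → AllPairs _<_ ps → All (_∣ n) ps → product ps ∣ n
product-primes-∣ [] n _ _ _ = 1∣ n
product-primes-∣ (p ∷ ps) .(k * p) (pp ∷ primes) (above ∷ sorted) (divides-refl k ∷ ps∣) =
  subst (p * product ps ∣_) (*-comm p k) (*-monoʳ-∣ p (product-primes-∣ ps k primes sorted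
    (All.zipWith (λ ((pq , p<q) , q∣kp) → prime∣m*p⇒∣m k pp pq p<q q∣kp) (All.zip (primes , above) , ps∣))))

-- Prime divisors and the product formulas for `φ` and `S₂`.

primeDivisor? : ∀ n p → Dec (Prime p × p ∣ n)
primeDivisor? n p = prime? p ×-dec p ∣? n

primeDivisors-sorted : ∀ n → AllPairs _<_ (primeDivisors n)
primeDivisors-sorted n = AllPairs.filter⁺ (primeDivisor? n) (AllPairs.applyUpTo⁺₁ id (suc n) (λ i<j _ → i<j))

primeDivisors-sound : ∀ n → All (λ p → Prime p × p ∣ n) (primeDivisors n)
primeDivisors-sound n = all-filter (primeDivisor? n) (upTo (suc n))

∈-primeDivisors : ∀ {n p} .{{_ : NonZero n}} → Prime p → p ∣ n → p ∈ primeDivisors n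
∈-primeDivisors {n} pp p∣n = ∈-filter⁺ (primeDivisor? n) (∈-upTo⁺ (s≤s (∣⇒≤ p∣n))) (pp , p∣n)

primeDivisor : ∀ n → .{{NonZero n}} → n ≢ 1 → ∃ λ p → Prime p × p ∣ n
primeDivisor n n≢1 with factorise n
... | record { factors = [] ; isFactorisation = n≡1 } = contradiction n≡1 n≢1
... | record { factors = p ∷ ps ; isFactorisation = refl ; factorsPrime = pp ∷ _ } = p , pp , m∣m*n (product ps)

-- A common divisor other than 1 has a prime factor, which then occurs in `primeDivisors n`.
coprime⇔avoids : ∀ k n .{{_ : NonZero n}} → Coprime k n ⇔ All (_∤ k) (primeDivisors n)
coprime⇔avoids k n = mk⇔
  (λ coprime → All.map (λ (pp , p∣n) p∣k → ¬prime[1] (subst Prime (coprime (p∣k , p∣n)) pp)) (primeDivisors-sound n))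
  λ avoid {d} (d∣k , d∣n) → decidable-stable (d ≟ 1) (λ d≢1 →
    let p , pp , p∣d = primeDivisor d {{≢-nonZero (λ { refl → ≢-nonZero⁻¹ n (0∣⇒≡0 d∣n) })}} d≢1
    in All.lookup avoid (∈-primeDivisors pp (∣-trans p∣d d∣n)) (∣-trans p∣d d∣k))

φ-formula : ∀ n m .{{_ : NonZero n}} → n ≡ m * rad n → φ n ≡ m * product (map (_∸ 1) (primeDivisors n))
φ-formula n m n≡ = begin-equality
  φ n                                           ≡⟨ cong (length ∘ filter (λ k → coprime? k n)) (map-applyUpTo id suc n) ⟩
  length (filter (λ k → coprime? k n) (applyUpTo suc n))
    ≡⟨ length-filter-applyUpTo (λ k → coprime? k n) suc (χ ps) n
         (λ i → cong 𝟙 (sym (does-⇔ (coprime⇔avoids (suc i) n) (coprime? (suc i) n) (avoids? ps (suc i))))) ⟩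
  Σ₁ (χ ps) n                                   ≡⟨ cong (Σ₁ (χ ps)) n≡ ⟩
  Σ₁ (χ ps) (m * product ps)                    ≡⟨ Σ₁-χ ps m (All.map proj₁ (primeDivisors-sound n)) (primeDivisors-sorted n) ⟩
  m * product (map (_∸ 1) ps)                   ∎
  where
  ps = primeDivisors n

prime⇒≥2 : ∀ {p} → Prime p → 2 ≤ p
prime⇒≥2 pp = nonTrivial⇒n>1 _ {{prime⇒nonTrivial pp}}

rad>0 : ∀ n → 0 < rad n
rad>0 n = productOfPrimes≥1 (All.map proj₁ (primeDivisors-sound n))

S₂-formula : ∀ n m → n ≡ m * rad n → S₂ n ≡ m * product (map (_∸ 2) (primeDivisors n))
S₂-formula n m n≡ = cong (_* product (map (_∸ 2) (primeDivisors n))) (begin-equality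
  n / r          ≡⟨ cong (_/ r) (trans n≡ (cong (m *_) (sym (m+[n∸m]≡n (rad>0 n))))) ⟩
  m * r / r      ≡⟨ m*n/n≡m m r ⟩
  m              ∎)
  where
  r = suc (rad n ∸ 1)

-- Reduction to the product bound.

map-∸1 : ∀ {ps} → All (2 ≤_) ps → map (_∸ 1) ps ≡ map suc (map (_∸ 2) ps)
map-∸1 [] = refl
map-∸1 (s≤s (s≤s z≤n) ∷ ps≥2) = cong (_ ∷_) (map-∸1 ps≥2)

product-∸1>0 : ∀ {ps} → All (2 ≤_) ps → 0 < product (map (_∸ 1) ps)
product-∸1>0 {ps} ps≥2 = subst (λ l → 0 < product l) (sym (map-∸1 ps≥2)) (product-suc>0 (map (_∸ 2) ps))

-- Factor by factor, p ≤ 2(p - 1) because p ≥ 2.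
product≤2^length*product∸1 : ∀ {ps} → All (2 ≤_) ps → product ps ≤ 2 ^ length ps * product (map (_∸ 1) ps)
product≤2^length*product∸1 [] = ≤-refl
product≤2^length*product∸1 {p@(suc (suc e)) ∷ ps} (s≤s (s≤s z≤n) ∷ ps≥2) = begin
  p * product ps                     ≤⟨ *-mono-≤ p≤ (product≤2^length*product∸1 ps≥2) ⟩
  2 * suc e * (2 ^ length ps * Φ)    ≡⟨ interchange (suc e) (2 ^ length ps) Φ ⟩
  2 * 2 ^ length ps * (suc e * Φ)    ∎
  where
  Φ = product (map (_∸ 1) ps)
  interchange : ∀ a b c → 2 * a * (b * c) ≡ 2 * b * (a * c)
  interchange = solve-∀
  double : ∀ e → 2 + e + e ≡ 2 * suc e
  double = solve-∀
  p≤ : p ≤ 2 * suc e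
  p≤ = ≤-trans (m≤m+n p e) (≤-reflexive (double e))

-- M = 1 solves the equation for a single factor, but with two or more the gap between the products
-- exceeds 1. The result starts both invariants of `productBound`.
multiplier≥2 : ∀ M d e es → 0 < M → 0 < d →
  M * product (d ∷ e ∷ es) + 1 ≡ product (map suc (d ∷ e ∷ es)) → 2 ≤ M
multiplier≥2 (suc (suc M)) d e es _ _ _ = s≤s (s≤s z≤n)
multiplier≥2 1 d e es _ 0<d eq = contradiction eq (<⇒≢ (begin-strict
  1 * (d * P) + 1           ≡⟨ cong (_+ 1) (*-identityˡ (d * P)) ⟩
  d * P + 1                 ≤⟨ +-monoʳ-≤ (d * P) 0<d ⟩
  d * P + d                 ≡⟨ +-comm (d * P) d ⟩
  d + d * P                 ≡⟨ *-suc d P ⟨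
  d * suc P                 ≤⟨ *-monoʳ-≤ d (product<product-suc e es) ⟩
  d * Q                     <⟨ m<n+m _ (product-suc>0 (e ∷ es)) ⟩
  suc d * Q                 ∎))
  where
  P = product (e ∷ es)
  Q = product (map suc (e ∷ es))

squarefreeBound : ∀ ps M → All Prime ps → AllPairs _<_ ps → Composite (product ps) → 0 < M →
  M * product (map (_∸ 2) ps) + 1 ≡ product (map (_∸ 1) ps) →
  product ps < 2 ^ (2 ^ length ps + length ps) ∸ 2 ^ (2 ^ (length ps ∸ 1) + length ps)
squarefreeBound [] M _ _ comp _ _ = contradiction comp ¬composite[1]
squarefreeBound (p ∷ []) M (pp ∷ []) _ comp _ _ =
  contradiction pp (composite⇒¬prime (subst Composite (*-identityʳ p) comp))
squarefreeBound (0 ∷ _ ∷ _) M (pp ∷ _) _ _ _ _ = contradiction pp ¬prime[0]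
squarefreeBound (1 ∷ _ ∷ _) M (pp ∷ _) _ _ _ _ = contradiction pp ¬prime[1]
-- For p = 2 the factor 2 - 2 reduces the left side to 1, while the next prime q > 2 makes the right
-- side at least 2.
squarefreeBound (2 ∷ q ∷ ps) M (_ ∷ _ ∷ primes) ((2<q ∷ _) ∷ _) _ _ eq = contradiction eq (<⇒≢ (begin-strict
  M * 0 + 1                                      ≡⟨ cong (_+ 1) (*-zeroʳ M) ⟩
  1                                              <⟨ *-mono-≤ (∸-monoˡ-≤ 1 2<q) (product-∸1>0 (All.map prime⇒≥2 primes)) ⟩
  (q ∸ 1) * product (map (_∸ 1) ps)              ≡⟨ *-identityˡ _ ⟨
  1 * ((q ∸ 1) * product (map (_∸ 1) ps))        ∎))
squarefreeBound ps@(suc (suc d@(suc _)) ∷ q ∷ qs) M primes sorted _ 0<M eq = begin-strict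
  product ps                              ≤⟨ product≤2^length*product∸1 ps≥2 ⟩
  2 ^ K * product (map (_∸ 1) ps)         <⟨ *-monoʳ-< (2 ^ K) {{m^n≢0 2 K}} totient< ⟩
  2 ^ K * (D * D ∸ D)                     ≡⟨ *-distribˡ-∸ (2 ^ K) (D * D) D ⟩
  2 ^ K * (D * D) ∸ 2 ^ K * D             ≡⟨ cong (λ x → 2 ^ K * x ∸ 2 ^ K * D) D² ⟩
  2 ^ K * 2 ^ (2 ^ K) ∸ 2 ^ K * D         ≡⟨ cong₂ _∸_ (power (2 ^ K)) (power (2 ^ (K ∸ 1))) ⟩
  2 ^ (2 ^ K + K) ∸ 2 ^ (2 ^ (K ∸ 1) + K) ∎
  where
  K = length ps
  D = 2 ^ (2 ^ (K ∸ 1))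
  es = map (_∸ 2) qs
  ps≥2 : All (2 ≤_) ps
  ps≥2 = All.map prime⇒≥2 primes
  power : ∀ a → 2 ^ K * 2 ^ a ≡ 2 ^ (a + K)
  power a = trans (*-comm (2 ^ K) (2 ^ a)) (sym (^-distribˡ-+-* 2 a K))
  D² : D * D ≡ 2 ^ (2 ^ K)
  D² = trans (sym (^-distribˡ-+-* 2 (2 ^ (K ∸ 1)) _)) (cong (λ a → 2 ^ (2 ^ (K ∸ 1) + a)) (sym (+-identityʳ _)))
  eq′ : M * product (d ∷ q ∸ 2 ∷ es) + 1 ≡ product (map suc (d ∷ q ∸ 2 ∷ es))
  eq′ = trans eq (cong product (map-∸1 ps≥2))
  2≤M : 2 ≤ M
  2≤M = multiplier≥2 M d (q ∸ 2) es 0<M z<s eq′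
  sorted′ : Linked _≤_ (1 ∷ d ∷ q ∸ 2 ∷ es)
  -- The leading 1 stands in for a previous factor: at F = X = 1 with exponent 1, both invariants
  -- reduce to 2 ≤ M.
  sorted′ = s≤s z≤n ∷ Linked.map⁺ (Linked.map (λ p<q → ∸-monoˡ-≤ 2 (<⇒≤ p<q)) (AllPairs⇒Linked sorted))
  inv₂ : 1 * 2 ^ 1 ≤ (M * 1) ^ 1 * 1
  inv₂ = ≤-trans 2≤M (≤-reflexive (ones M))
    where
    ones : ∀ M → M ≡ M * 1 * 1 * 1
    ones = solve-∀
  totient< : product (map (_∸ 1) ps) < D * D ∸ D
  totient< = m+n≤o⇒m≤o∸n _ (subst₂ (λ x l → let D = 2 ^ (2 ^ suc l) in x + D < D * D)
    (trans (*-identityˡ _) (cong product (sym (map-∸1 ps≥2)))) (length-map (_∸ 2) qs)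
    (productBound 1 1 M 1 d (q ∸ 2 ∷ es) z<s z<s z<s sorted′
      (≤-trans 2≤M (≤-reflexive (sym (*-identityʳ M)))) inv₂
      (trans eq′ (sym (*-identityˡ _)))))

theorem1p2 : (n : ℕ) → Composite n → (M : ℕ) → 0 < M → M * S₂ n ≡ φ n ∸ 1 →
    n < 2 ^ (2 ^ ω n + ω n) ∸ 2 ^ (2 ^ (ω n ∸ 1) + ω n)
theorem1p2 n comp M 0<M eq = subst (_< 2 ^ (2 ^ ω n + ω n) ∸ 2 ^ (2 ^ (ω n ∸ 1) + ω n)) (sym n≡rad)
  (squarefreeBound ps M primes (primeDivisors-sorted n) (subst Composite n≡rad comp) 0<M eq₁)
  where
  instance
    n≢0 : NonZero n
    n≢0 = composite⇒nonZero comp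
  ps = primeDivisors n
  σ = product (map (_∸ 2) ps)
  Φ = product (map (_∸ 1) ps)
  primes : All Prime ps
  primes = All.map proj₁ (primeDivisors-sound n)
  rad∣n : rad n ∣ n
  rad∣n = product-primes-∣ ps n primes (primeDivisors-sorted n) (All.map proj₂ (primeDivisors-sound n))
  m = quotient rad∣n
  n≡m*rad : n ≡ m * rad n
  n≡m*rad = _∣_.equality rad∣n
  m>0 : 0 < m
  m>0 = n≢0⇒n>0 (λ m≡0 → ≢-nonZero⁻¹ n (trans n≡m*rad (cong (_* rad n) m≡0)))
  -- Positivity makes the truncated `φ n ∸ 1` a true subtraction.
  φ>0 : 0 < m * Φ
  φ>0 = *-mono-≤ m>0 (product-∸1>0 (All.map prime⇒≥2 primes))
  swap : ∀ a b c → a * (b * c) ≡ b * (a * c)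
  swap = solve-∀
  eqₘ : m * (M * σ) + 1 ≡ m * Φ
  eqₘ = begin-equality
    m * (M * σ) + 1   ≡⟨ cong (_+ 1) (swap m M σ) ⟩
    M * (m * σ) + 1   ≡⟨ cong (λ s → M * s + 1) (S₂-formula n m n≡m*rad) ⟨
    M * S₂ n + 1      ≡⟨ cong (_+ 1) eq ⟩
    φ n ∸ 1 + 1       ≡⟨ cong (λ x → x ∸ 1 + 1) (φ-formula n m n≡m*rad) ⟩
    m * Φ ∸ 1 + 1     ≡⟨ m∸n+n≡m φ>0 ⟩
    m * Φ             ∎
  -- m divides both m Φ and m (M σ), which differ by 1.
  m≡1 : m ≡ 1
  m≡1 = ∣1⇒≡1 (∣m+n∣m⇒∣n (subst (m ∣_) (sym eqₘ) (m∣m*n Φ)) (m∣m*n (M * σ)))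
  n≡rad : n ≡ product ps
  n≡rad = trans n≡m*rad (trans (cong (_* rad n) m≡1) (*-identityˡ (rad n)))
  eq₁ : M * σ + 1 ≡ Φ
  eq₁ = begin-equality
    M * σ + 1         ≡⟨ cong (_+ 1) (*-identityˡ (M * σ)) ⟨
    1 * (M * σ) + 1   ≡⟨ cong (λ x → x * (M * σ) + 1) m≡1 ⟨
    m * (M * σ) + 1   ≡⟨ eqₘ ⟩
    m * Φ             ≡⟨ cong (_* Φ) m≡1 ⟩
    1 * Φ             ≡⟨ *-identityˡ Φ ⟩
    Φ                 ∎
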